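{- Suppose a binary linear code $[k,t,r]$ exists. Then for any set $I\subseteq[n]$ of $k$ variables and any collection $\mathcal{A}\subseteq\{0,1\}^n$ of assignments with $|\mathcal{A}|\le 2^t-1$, there exists a distribution $\mathcal{Q}_I$ over sign patterns $\{0,1\}^k$ on $I$ such that: (i) for every sign pattern $x$ in the support of $\mathcal{Q}_I$, the clause $C=(I,x)$ is satisfied by every assignment in $\mathcal{A}$; and (ii) if $x\sim\mathcal{Q}_I$, then the marginal distribution of $x$ on any subset of $r-1$ coordinates is uniform.
   Context: A binary linear code $[k,t,r]$ is a $t$-dimensional linear subspace of $\mathbb{F}_2^k$ in which any two distinct codewords have Hamming distance at least $r$ (minimum distance $r$). The variables in $I$ are listed in a fixed order $I[1],\dots,I[k]$. A clause $(I,x)$ with $x\in\{0,1\}^k$ is satisfied by an assignment $\sigma\in\{0,1\}^n$ if there is $i\in[k]$ with $x[i]=\sigma[I[i]]$. -}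

module Defs where

open import Data.Bool.Base using (Bool; true; false; _∧_; _xor_; if_then_else_)
import Data.Bool.Properties as Bool
open import Data.Fin.Base using (Fin)
open import Data.Fin.Subset using (Subset; inside; outside; ∣_∣)
open import Data.Integer.Base using (+_)
open import Data.Nat.Base using (ℕ; zero; suc; _^_) renaming (_≤_ to _≤ⁿ_)
open import Data.Nat.Properties using (m^n≢0)
open import Data.Product.Base using (_×_; _,_; ∃-syntax)
open import Data.Rational.Base using (ℚ; 0ℚ; 1ℚ; _+_; _≤_; _/_)
open import Data.Vec.Base
  using (Vec; []; _∷_; lookup; map; zip; zipWith; replicate; foldr′; count)
open import Data.Vec.Properties using (≡-dec)
open import Data.Vec.Relation.Unary.All using (All)
open import Function.Bundles using (_↣_; module Injection)
open import Level using (0ℓ)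
open import Relation.Binary.PropositionalEquality using (_≡_; _≢_)
open import Relation.Nullary.Decidable using (does; ¬?)
open import Relation.Unary using (Pred; Decidable; _∈_)

-- Bits n is 𝔽₂ⁿ as well as {0,1}ⁿ.  The field 𝔽₂ is Bool with addition _xor_
-- and multiplication _∧_ (Data.Bool.Properties.xor-∧-commutativeRing).
Bits : ℕ → Set
Bits = Vec Bool

infixl 6 _⊕_
infixr 7 _·_

𝟎 : ∀ {n} → Bits n
𝟎 = replicate _ false

_⊕_ : ∀ {n} → Bits n → Bits n → Bits n
_⊕_ = zipWith _xor_

_·_ : ∀ {n} → Bool → Bits n → Bits n
a · v = map (a ∧_) v

linComb : ∀ {n t} → Bits t → Vec (Bits n) t → Bits n
linComb as vs = foldr′ _⊕_ 𝟎 (zipWith _·_ as vs)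

record IsSubspace {n} (V : Pred (Bits n) 0ℓ) : Set where
  field
    𝟎-mem    : 𝟎 ∈ V
    ⊕-closed : ∀ {u v} → u ∈ V → v ∈ V → u ⊕ v ∈ V
    ·-closed : ∀ a {v} → v ∈ V → a · v ∈ V

record IsBasis {n t} (V : Pred (Bits n) 0ℓ) (vs : Vec (Bits n) t) : Set where
  field
    members     : All V vs
    independent : ∀ as → linComb as vs ≡ 𝟎 → as ≡ 𝟎
    spanning    : ∀ {v} → v ∈ V → ∃[ as ] v ≡ linComb as vs

hamming : ∀ {n} → Bits n → Bits n → ℕ
hamming x y = count (λ (a , b) → ¬? (a Bool.≟ b)) (zip x y)

record LinearCode (k t r : ℕ) : Set₁ where
  field
    Codeword   : Pred (Bits k) 0ℓ
    isSubspace : IsSubspace Codeword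
    basis      : Vec (Bits k) t
    isBasis    : IsBasis Codeword basis
    distance   : ∀ {x y} → x ∈ Codeword → y ∈ Codeword → x ≢ y → r ≤ⁿ hamming x y

-- The injection is the listing I[1], …, I[k] of a set I of k variables out of n.
Clause : ℕ → ℕ → Set
Clause n k = (Fin k ↣ Fin n) × Bits k

Satisfies : ∀ {n k} → Bits n → Clause n k → Set
Satisfies σ (I , x) = ∃[ i ] lookup x i ≡ lookup σ (Injection.to I i)

∑ : ∀ {k} → (Bits k → ℚ) → ℚ
∑ {zero}  f = f []
∑ {suc k} f = ∑ (λ x → f (false ∷ x)) + ∑ (λ x → f (true ∷ x))

record Distribution (k : ℕ) : Set where
  field
    mass        : Bits k → ℚ
    nonNegative : ∀ x → 0ℚ ≤ mass x
    total       : ∑ mass ≡ 1ℚ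

open Distribution public

Support : ∀ {k} → Distribution k → Pred (Bits k) 0ℓ
Support Q x = mass Q x ≢ 0ℚ

Pr : ∀ {k} → Distribution k → {P : Pred (Bits k) 0ℓ} → Decidable P → ℚ
Pr Q P? = ∑ λ x → if does (P? x) then mass Q x else 0ℚ

restrict : ∀ {k} (S : Subset k) → Bits k → Bits ∣ S ∣
restrict []            []      = []
restrict (inside  ∷ S) (b ∷ x) = b ∷ restrict S x
restrict (outside ∷ S) (b ∷ x) = restrict S x

marginal : ∀ {k} → Distribution k → (S : Subset k) → Bits ∣ S ∣ → ℚ
marginal Q S y = Pr Q λ x → ≡-dec Bool._≟_ (restrict S x) y

Uniform : ∀ {m} → (Bits m → ℚ) → Set
Uniform {m} p = ∀ y → p y ≡ (+ 1 / 2 ^ m) {{m^n≢0 2 m}}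

{-# OPTIONS --safe #-}
-- The clause (I , x) is falsified by σ exactly when x is the complement of σ
-- on I.  Split 𝔽₂ᵏ into the 2ᵗ cosets of the dual code, indexed by syndromes;
-- fewer than 2ᵗ assignments leave some coset free of complements, and Q is
-- uniform on that coset.  Expanding indicators in characters, the Fourier
-- coefficient of Q at v vanishes unless v is a codeword, hence at every nonzero
-- v of weight below r; this makes all marginals on r - 1 coordinates uniform.
module Submission where

open import Defs
open import Data.Bool.Base using (Bool; true; false; not; _∧_; _xor_; if_then_else_)
import Data.Bool.Properties as Bool
open import Data.Fin.Base using (Fin)
open import Data.Fin.Properties using (any?)
open import Data.Fin.Subset using (Subset; inside; outside; ∣_∣)
open import Data.Integer.Base using (1ℤ)
open import Data.List.Base as List using (List; []; _∷_; length)
open import Data.List.Membership.Propositional using () renaming (_∈_ to _∈ˡ_; _∉_ to _∉ˡ_)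
open import Data.List.Membership.Propositional.Properties using (∈-map⁺)
open import Data.List.Properties using (length-map)
open import Data.List.Relation.Unary.All using (All)
import Data.List.Relation.Unary.All as All
open import Data.List.Relation.Unary.Any using (here; there)
open import Data.List.Relation.Unary.Unique.Propositional using (Unique)
open import Data.Nat.Base as ℕ using (ℕ; zero; suc; _≤_; _<_; z≤n; s≤s; _∸_; _^_)
import Data.Nat.Properties as ℕ
open import Data.Product.Base using (Σ-syntax; ∃-syntax; _×_; _,_)
open import Data.Rational.Base as ℚ using (ℚ; 0ℚ; 1ℚ; ½; _+_; _*_; -_; _/_)
import Data.Rational.Properties as ℚ
open import Data.Rational.Solver using (module +-*-Solver)
import Data.Rational.Unnormalised.Base as ℚᵘ
import Data.Rational.Unnormalised.Properties as ℚᵘ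
open import Data.Vec.Base as Vec using (Vec; []; _∷_; lookup; map; tabulate)
open import Data.Vec.Properties
  using (≡-dec; map-const; zipWith-identityˡ; tabulate-cong; tabulate∘lookup)
import Data.Vec.Relation.Unary.All as VecAll
open import Function.Base using (_∘_)
open import Function.Bundles using (_↣_; module Injection)
open import Level using (0ℓ)
open import Relation.Binary.PropositionalEquality
  using (_≡_; _≢_; refl; sym; trans; cong; cong₂; subst; subst₂; module ≡-Reasoning)
open import Relation.Nullary.Decidable using (does; yes; no; dec-true; dec-false)
open import Relation.Nullary.Negation using (contradiction)
open import Relation.Unary using (Pred; _∈_)

open ≡-Reasoning

-- Finite sums over the Boolean cube, and powers of two.

∑-cong : ∀ {n} {f g : Bits n → ℚ} → (∀ x → f x ≡ g x) → ∑ f ≡ ∑ g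
∑-cong {zero}  eq = eq []
∑-cong {suc n} eq = cong₂ _+_ (∑-cong (eq ∘ (false ∷_))) (∑-cong (eq ∘ (true ∷_)))

*-distribˡ-∑ : ∀ {n} c (f : Bits n → ℚ) → c * ∑ f ≡ ∑ (λ x → c * f x)
*-distribˡ-∑ {zero}  c f = refl
*-distribˡ-∑ {suc n} c f =
  trans (ℚ.*-distribˡ-+ c _ _) (cong₂ _+_ (*-distribˡ-∑ {n} c _) (*-distribˡ-∑ {n} c _))

*-distribʳ-∑ : ∀ {n} c (f : Bits n → ℚ) → ∑ f * c ≡ ∑ (λ x → f x * c)
*-distribʳ-∑ {zero}  c f = refl
*-distribʳ-∑ {suc n} c f =
  trans (ℚ.*-distribʳ-+ c (∑ (f ∘ (false ∷_))) (∑ (f ∘ (true ∷_)))) (cong₂ _+_ (*-distribʳ-∑ {n} c _) (*-distribʳ-∑ {n} c _))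

∑-distrib-+ : ∀ {n} (f g : Bits n → ℚ) → ∑ (λ x → f x + g x) ≡ ∑ f + ∑ g
∑-distrib-+ {zero}  f g = refl
∑-distrib-+ {suc n} f g =
  trans (cong₂ _+_ (∑-distrib-+ (f ∘ (false ∷_)) _) (∑-distrib-+ (f ∘ (true ∷_)) _))
        (solve 4 (λ a b c d → (a :+ b) :+ (c :+ d) := (a :+ c) :+ (b :+ d)) refl
           (∑ (f ∘ (false ∷_))) (∑ (g ∘ (false ∷_))) (∑ (f ∘ (true ∷_))) (∑ (g ∘ (true ∷_))))
  where open +-*-Solver

∑-comm : ∀ {m n} (f : Bits m → Bits n → ℚ) →
         ∑ (λ x → ∑ (λ y → f x y)) ≡ ∑ (λ y → ∑ (λ x → f x y))
∑-comm {zero}  f = refl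
∑-comm {suc m} f =
  trans (cong₂ _+_ (∑-comm (f ∘ (false ∷_))) (∑-comm (f ∘ (true ∷_)))) (sym (∑-distrib-+ (λ y → ∑ (λ x → f (false ∷ x) y)) _))

∑-zero : ∀ {n} {f : Bits n → ℚ} → (∀ x → f x ≡ 0ℚ) → ∑ f ≡ 0ℚ
∑-zero {zero}  eq = eq []
∑-zero {suc n} eq = cong₂ _+_ (∑-zero (eq ∘ (false ∷_))) (∑-zero (eq ∘ (true ∷_)))

∑-only-𝟎 : ∀ {n} {f : Bits n → ℚ} → (∀ x → x ≢ 𝟎 → f x ≡ 0ℚ) → ∑ f ≡ f 𝟎
∑-only-𝟎 {zero}      eq = refl
∑-only-𝟎 {suc n} {f} eq =
  trans (cong₂ _+_ (∑-only-𝟎 (λ x x≢𝟎 → eq (false ∷ x) λ { refl → x≢𝟎 refl }))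
                   (∑-zero (λ x → eq (true ∷ x) λ ())))
        (ℚ.+-identityʳ _)

-- The rational number 2 to the power `n`, kept as a sum so that `card (suc n)` unfolds to
-- `card n + card n`, the form met in inductions on coordinates.
card : ℕ → ℚ
card n = ∑ {n} (λ _ → 1ℚ)

-- The same expression as the value demanded by `Uniform`, so no conversion is left at the end.
2^-_ : ℕ → ℚ
2^- n = (1ℤ / 2 ^ n) {{ℕ.m^n≢0 2 n}}

-- Division in `ℚ` normalises by a gcd that does not compute for variable `n`. Among unnormalised
-- rationals both sides are represented by the product `1/2n`.
1/2*n≡½*1/n : ∀ n .{{_ : ℕ.NonZero n}} → (1ℤ / (2 ℕ.* n)) {{ℕ.m*n≢0 2 n}} ≡ ½ * (1ℤ / n)
1/2*n≡½*1/n (suc d) = ℚ.toℚᵘ-injective (ℚᵘ.≃-trans (ℚ.toℚᵘ-fromℚᵘ 1/2n)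
  (ℚᵘ.≃-sym (ℚᵘ.≃-trans (ℚ.toℚᵘ-homo-* ½ (ℚ.fromℚᵘ 1/n)) (ℚᵘ.*-congˡ {ℚᵘ.½} (ℚ.toℚᵘ-fromℚᵘ 1/n)))))
  where
  1/n 1/2n : ℚᵘ.ℚᵘ
  1/n  = ℚᵘ.mkℚᵘ 1ℤ d
  1/2n = ℚᵘ.½ ℚᵘ.* 1/n

2^-n*card≡1 : ∀ n → 2^- n * card n ≡ 1ℚ
2^-n*card≡1 zero    = refl
2^-n*card≡1 (suc n) = begin
  2^- suc n * (card n + card n)      ≡⟨ cong (_* (card n + card n)) (1/2*n≡½*1/n (2 ^ n) {{ℕ.m^n≢0 2 n}}) ⟩
  ½ * 2^- n * (card n + card n)      ≡⟨ solve 2 (λ w c → con ½ :* w :* (c :+ c) := w :* c) refl (2^- n) (card n) ⟩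
  2^- n * card n                     ≡⟨ 2^-n*card≡1 n ⟩
  1ℚ                                 ∎
  where open +-*-Solver

-- The sign character of 𝔽₂, the standard bilinear form, and syndromes.

χ : Bool → ℚ
χ b = if b then - 1ℚ else 1ℚ

χ-xor : ∀ a b → χ (a xor b) ≡ χ a * χ b
χ-xor false b     = sym (ℚ.*-identityˡ (χ b))
χ-xor true  false = refl
χ-xor true  true  = refl

dot : ∀ {n} → Bits n → Bits n → Bool
dot []      []      = false
dot (a ∷ u) (b ∷ v) = (a ∧ b) xor dot u v

dot-𝟎ˡ : ∀ {n} (v : Bits n) → dot 𝟎 v ≡ false
dot-𝟎ˡ []      = refl
dot-𝟎ˡ (b ∷ v) = dot-𝟎ˡ v

dot-𝟎ʳ : ∀ {n} (u : Bits n) → dot u 𝟎 ≡ false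
dot-𝟎ʳ []      = refl
dot-𝟎ʳ (a ∷ u) = trans (cong (_xor dot u 𝟎) (Bool.∧-zeroʳ a)) (dot-𝟎ʳ u)

dot-⊕ : ∀ {n} (x u v : Bits n) → dot x (u ⊕ v) ≡ dot x u xor dot x v
dot-⊕ []      []      []      = refl
dot-⊕ (a ∷ x) (b ∷ u) (c ∷ v) =
  trans (cong₂ _xor_ (Bool.∧-distribˡ-xor a b c) (dot-⊕ x u v))
        (interchange (a ∧ b) (a ∧ c) (dot x u) (dot x v))
  where
  open import Algebra.Bundles using (module CommutativeRing)
  open import Algebra.Properties.CommutativeSemigroup
    (CommutativeRing.+-commutativeSemigroup Bool.xor-∧-commutativeRing) using (interchange)

dot-· : ∀ {n} (x : Bits n) a v → dot x (a · v) ≡ a ∧ dot x v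
dot-· []      a     []      = sym (Bool.∧-zeroʳ a)
dot-· (b ∷ x) false (c ∷ v) = trans (cong (_xor dot x (false · v)) (Bool.∧-zeroʳ b)) (dot-· x false v)
dot-· (b ∷ x) true  (c ∷ v) = cong ((b ∧ c) xor_) (dot-· x true v)

-- For `vs` a basis of the code, its rows form a parity-check matrix of the dual code, and the
-- fibres of this map are the cosets of that dual.
syndrome : ∀ {n t} → Vec (Bits n) t → Bits n → Bits t
syndrome vs x = map (dot x) vs

-- `syndrome vs` and the formation of linear combinations are transposes of each other. A character
-- of the syndrome thereby becomes a character of `x` indexed by a codeword.
dot-syndrome : ∀ {n t} (as : Bits t) (vs : Vec (Bits n) t) x →
               dot as (syndrome vs x) ≡ dot x (linComb as vs)
dot-syndrome []       []       x = sym (dot-𝟎ʳ x)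
dot-syndrome (a ∷ as) (v ∷ vs) x = sym (trans (dot-⊕ x (a · v) (linComb as vs))
  (cong₂ _xor_ (dot-· x a v) (sym (dot-syndrome as vs x))))

linComb-𝟎 : ∀ {n t} (vs : Vec (Bits n) t) → linComb 𝟎 vs ≡ 𝟎
linComb-𝟎 []       = refl
linComb-𝟎 (v ∷ vs) =
  trans (cong₂ _⊕_ (map-const v false) (linComb-𝟎 vs)) (zipWith-identityˡ Bool.xor-identityˡ 𝟎)

linComb-closed : ∀ {n t} {V : Pred (Bits n) 0ℓ} → IsSubspace V →
                 ∀ as {vs : Vec (Bits n) t} → VecAll.All V vs → linComb as vs ∈ V
linComb-closed V []       VecAll.[]         = IsSubspace.𝟎-mem V
linComb-closed V (a ∷ as) (v∈V VecAll.∷ vs) =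
  IsSubspace.⊕-closed V (IsSubspace.·-closed V a v∈V) (linComb-closed V as vs)

-- Indicators and the orthogonality of characters.

δ : ∀ {n} → Bits n → Bits n → ℚ
δ u v = if does (≡-dec Bool._≟_ u v) then 1ℚ else 0ℚ

δ-≡ : ∀ {n} {u v : Bits n} → u ≡ v → δ u v ≡ 1ℚ
δ-≡ {u = u} {v} u≡v = cong (if_then 1ℚ else 0ℚ) (dec-true (≡-dec Bool._≟_ u v) u≡v)

δ-≢ : ∀ {n} {u v : Bits n} → u ≢ v → δ u v ≡ 0ℚ
δ-≢ {u = u} {v} u≢v = cong (if_then 1ℚ else 0ℚ) (dec-false (≡-dec Bool._≟_ u v) u≢v)

-- Splitting on the first bit of `x`, the two halves of the sum differ by the factor `χ b * χ c`:
-- equal heads double the sum for the tails, opposite heads cancel it.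
χ-orthogonal : ∀ {n} (u v : Bits n) →
               ∑ (λ x → χ (dot x u) * χ (dot x v)) ≡ card n * δ u v
χ-orthogonal []      []      = refl
χ-orthogonal {suc n} (b ∷ u) (c ∷ v) = begin
  S + ∑ (λ x → χ (b xor dot x u) * χ (c xor dot x v))
    ≡⟨ cong (S +_) (∑-cong λ x → trans (cong₂ _*_ (χ-xor b (dot x u)) (χ-xor c (dot x v)))
         (solve 4 (λ p q r s → (p :* q) :* (r :* s) := (p :* r) :* (q :* s)) refl
            (χ b) (χ (dot x u)) (χ c) (χ (dot x v)))) ⟩
  S + ∑ (λ x → (χ b * χ c) * (χ (dot x u) * χ (dot x v)))
    ≡⟨ cong (S +_) (*-distribˡ-∑ {n} (χ b * χ c) _) ⟨
  S + (χ b * χ c) * S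
    ≡⟨ cong (λ s → s + (χ b * χ c) * s) (χ-orthogonal u v) ⟩
  card n * δ u v + (χ b * χ c) * (card n * δ u v)
    ≡⟨ heads b c ⟩
  card (suc n) * δ (b ∷ u) (c ∷ v) ∎
  where
  open +-*-Solver
  S = ∑ (λ x → χ (dot x u) * χ (dot x v))
  equal : card n * δ u v + 1ℚ * (card n * δ u v) ≡ card (suc n) * δ u v
  equal = solve 2 (λ m d → m :* d :+ con 1ℚ :* (m :* d) := (m :+ m) :* d) refl (card n) (δ u v)
  opposite : card n * δ u v + (- 1ℚ) * (card n * δ u v) ≡ card (suc n) * 0ℚ
  opposite = solve 2 (λ m d → m :* d :+ con (- 1ℚ) :* (m :* d) := (m :+ m) :* con 0ℚ) refl (card n) (δ u v)
  heads : ∀ b c → card n * δ u v + (χ b * χ c) * (card n * δ u v) ≡ card (suc n) * δ (b ∷ u) (c ∷ v)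
  heads false false = equal
  heads false true  = opposite
  heads true  false = opposite
  heads true  true  = equal

-- Nonnegativity.

0≤1 : 0ℚ ℚ.≤ 1ℚ
0≤1 = ℚ.nonNegative⁻¹ 1ℚ

0≤δ : ∀ {n} (u v : Bits n) → 0ℚ ℚ.≤ δ u v
0≤δ u v with does (≡-dec Bool._≟_ u v)
... | true  = 0≤1
... | false = ℚ.≤-refl

∑-nonNegative : ∀ {n} {f : Bits n → ℚ} → (∀ x → 0ℚ ℚ.≤ f x) → 0ℚ ℚ.≤ ∑ f
∑-nonNegative {zero}  0≤f = 0≤f []
∑-nonNegative {suc n} 0≤f =
  ℚ.+-mono-≤ (∑-nonNegative (0≤f ∘ (false ∷_))) (∑-nonNegative (0≤f ∘ (true ∷_)))

0≤2^- : ∀ n → 0ℚ ℚ.≤ 2^- n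
0≤2^- n = ℚ.nonNegative⁻¹ _ {{ℚ.normalize-nonNeg 1 (2 ^ n) {{ℕ.m^n≢0 2 n}}}}

*-nonNegative : ∀ {p q} → 0ℚ ℚ.≤ p → 0ℚ ℚ.≤ q → 0ℚ ℚ.≤ p * q
*-nonNegative {p} {q} 0≤p 0≤q = ℚ.nonNegative⁻¹ (p * q)
  {{ℚ.nonNeg*nonNeg⇒nonNeg p {{ℚ.nonNegative 0≤p}} q {{ℚ.nonNegative 0≤q}}}}

-- Extension by zero from a set of coordinates.

embed : ∀ {k} (S : Subset k) → Bits ∣ S ∣ → Bits k
embed []            []      = []
embed (inside  ∷ S) (b ∷ y) = b ∷ embed S y
embed (outside ∷ S) y       = false ∷ embed S y

embed≡𝟎⇒≡𝟎 : ∀ {k} (S : Subset k) y → embed S y ≡ 𝟎 → y ≡ 𝟎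
embed≡𝟎⇒≡𝟎 []            []      _  = refl
embed≡𝟎⇒≡𝟎 (inside  ∷ S) (b ∷ y) eq = cong₂ _∷_ (cong Vec.head eq) (embed≡𝟎⇒≡𝟎 S y (cong Vec.tail eq))
embed≡𝟎⇒≡𝟎 (outside ∷ S) y       eq = embed≡𝟎⇒≡𝟎 S y (cong Vec.tail eq)

embed-𝟎 : ∀ {k} (S : Subset k) → embed S 𝟎 ≡ 𝟎
embed-𝟎 []            = refl
embed-𝟎 (inside  ∷ S) = cong (false ∷_) (embed-𝟎 S)
embed-𝟎 (outside ∷ S) = cong (false ∷_) (embed-𝟎 S)

-- Extension by zero is the transpose of restriction, so characters on the coordinates in `S` are
-- characters of the whole cube with frequency supported in `S`.
dot-restrict : ∀ {k} (S : Subset k) y x → dot y (restrict S x) ≡ dot x (embed S y)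
dot-restrict []            []      []      = refl
dot-restrict (inside  ∷ S) (b ∷ y) (a ∷ x) = cong₂ _xor_ (Bool.∧-comm b a) (dot-restrict S y x)
dot-restrict (outside ∷ S) y       (a ∷ x) =
  trans (dot-restrict S y x) (cong (_xor dot x (embed S y)) (sym (Bool.∧-zeroʳ a)))

weight-embed : ∀ {k} (S : Subset k) y → hamming (embed S y) 𝟎 ≤ ∣ S ∣
weight-embed []            []          = z≤n
weight-embed (inside  ∷ S) (false ∷ y) = ℕ.m≤n⇒m≤1+n (weight-embed S y)
weight-embed (inside  ∷ S) (true  ∷ y) = s≤s (weight-embed S y)
weight-embed (outside ∷ S) y           = weight-embed S y

length≡0⇒≡𝟎 : ∀ {n} → n ≡ 0 → (x : Bits n) → x ≡ 𝟎
length≡0⇒≡𝟎 refl [] = refl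

-- For r = 0 the truncated r ∸ 1 is 0 rather than -1, so S is empty and y is 𝟎.
embed-light : ∀ {k} r (S : Subset k) → ∣ S ∣ ≡ r ∸ 1 → ∀ {y} → y ≢ 𝟎 → hamming (embed S y) 𝟎 < r
embed-light zero    S ∣S∣≡0 {y} y≢𝟎 = contradiction (length≡0⇒≡𝟎 ∣S∣≡0 y) y≢𝟎
embed-light (suc r) S ∣S∣≡r {y} _   = s≤s (ℕ.≤-trans (weight-embed S y) (ℕ.≤-reflexive ∣S∣≡r))

-- The uniform distribution on a coset of the dual code.

module _ {k t r} (C : LinearCode k t r) (s : Bits t) where
  open LinearCode C
  open IsBasis isBasis

  -- The fibre of the syndrome over s has 2 ^ k / 2 ^ t elements.
  cosetMass : Bits k → ℚ
  cosetMass x = 2^- k * (card t * δ (syndrome basis x) s)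

  -- Orthogonality is used twice: over `Bits t` to expand the indicator of the syndrome, then, after
  -- exchanging the sums, over `Bits k` to compare the codeword `linComb a basis` with `v`.
  cosetMass-fourier : ∀ v → ∑ (λ x → cosetMass x * χ (dot x v))
                          ≡ ∑ (λ a → χ (dot a s) * δ (linComb a basis) v)
  cosetMass-fourier v = begin
    ∑ (λ x → cosetMass x * χ (dot x v))
      ≡⟨ ∑-cong (λ x → begin
           2^- k * (card t * δ (syndrome basis x) s) * χ (dot x v)
             -- Orthogonality read from right to left; it absorbs the factor `card t` of the mass.
             ≡⟨ cong (λ p → 2^- k * p * χ (dot x v)) (χ-orthogonal (syndrome basis x) s) ⟨
           2^- k * ∑ (λ a → χ (dot a (syndrome basis x)) * χ (dot a s)) * χ (dot x v)
             ≡⟨ ℚ.*-assoc (2^- k) _ _ ⟩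
           2^- k * (∑ (λ a → χ (dot a (syndrome basis x)) * χ (dot a s)) * χ (dot x v))
             ≡⟨ cong (2^- k *_) (trans (*-distribʳ-∑ {t} (χ (dot x v)) _) (∑-cong λ a →
                  trans (cong (λ b → χ b * χ (dot a s) * χ (dot x v)) (dot-syndrome a basis x))
                    (solve 3 (λ p q u → p :* q :* u := q :* (p :* u)) refl
                      (χ (dot x (linComb a basis))) (χ (dot a s)) (χ (dot x v))))) ⟩
           2^- k * ∑ (λ a → F a x) ∎) ⟩
    ∑ (λ x → 2^- k * ∑ (λ a → F a x))
      ≡⟨ *-distribˡ-∑ {k} (2^- k) _ ⟨
    2^- k * ∑ (λ x → ∑ (λ a → F a x))
      ≡⟨ cong (2^- k *_) (∑-comm (λ x a → F a x)) ⟩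
    2^- k * ∑ (λ a → ∑ (F a))
      ≡⟨ *-distribˡ-∑ {t} (2^- k) _ ⟩
    ∑ (λ a → 2^- k * ∑ (F a))
      ≡⟨ ∑-cong (λ a → begin
           2^- k * ∑ (F a)
             ≡⟨ cong (2^- k *_) (*-distribˡ-∑ {k} (χ (dot a s)) _) ⟨
           2^- k * (χ (dot a s) * ∑ (λ x → χ (dot x (linComb a basis)) * χ (dot x v)))
             ≡⟨ cong (λ p → 2^- k * (χ (dot a s) * p)) (χ-orthogonal (linComb a basis) v) ⟩
           2^- k * (χ (dot a s) * (card k * δ (linComb a basis) v))
             ≡⟨ solve 4 (λ w c m d → w :* (c :* (m :* d)) := (w :* m) :* (c :* d)) refl
                  (2^- k) (χ (dot a s)) (card k) (δ (linComb a basis) v) ⟩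
           (2^- k * card k) * (χ (dot a s) * δ (linComb a basis) v)
             ≡⟨ cong (_* (χ (dot a s) * δ (linComb a basis) v)) (2^-n*card≡1 k) ⟩
           1ℚ * (χ (dot a s) * δ (linComb a basis) v)
             ≡⟨ ℚ.*-identityˡ _ ⟩
           χ (dot a s) * δ (linComb a basis) v ∎) ⟩
    ∑ (λ a → χ (dot a s) * δ (linComb a basis) v) ∎
    where
    open +-*-Solver
    F : Bits t → Bits k → ℚ
    F a x = χ (dot a s) * (χ (dot x (linComb a basis)) * χ (dot x v))

  -- Independence of the basis leaves only the term `a = 𝟎`. The coefficient is the total mass, so
  -- in particular the coset is inhabited.
  cosetMass-fourier-𝟎 : ∑ (λ x → cosetMass x * χ (dot x 𝟎)) ≡ 1ℚ
  cosetMass-fourier-𝟎 = begin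
    ∑ (λ x → cosetMass x * χ (dot x 𝟎))
      ≡⟨ cosetMass-fourier 𝟎 ⟩
    ∑ (λ a → χ (dot a s) * δ (linComb a basis) 𝟎)
      ≡⟨ ∑-only-𝟎 (λ a a≢𝟎 → trans (cong (χ (dot a s) *_) (δ-≢ (a≢𝟎 ∘ independent a)))
                                   (ℚ.*-zeroʳ (χ (dot a s)))) ⟩
    χ (dot 𝟎 s) * δ (linComb 𝟎 basis) 𝟎
      ≡⟨ cong₂ (λ b d → χ b * d) (dot-𝟎ˡ s) (δ-≡ (linComb-𝟎 basis)) ⟩
    1ℚ ∎

  -- A combination of the basis equal to `v` would be a codeword other than `𝟎` at distance less
  -- than `r` from the codeword `𝟎`; hence every term vanishes.
  cosetMass-fourier-light : ∀ {v} → v ≢ 𝟎 → hamming v 𝟎 < r →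
                            ∑ (λ x → cosetMass x * χ (dot x v)) ≡ 0ℚ
  cosetMass-fourier-light {v} v≢𝟎 light = trans (cosetMass-fourier v) (∑-zero λ a →
    trans (cong (χ (dot a s) *_) (δ-≢ (notCodeword a))) (ℚ.*-zeroʳ (χ (dot a s))))
    where
    notCodeword : ∀ a → linComb a basis ≢ v
    notCodeword a refl = ℕ.<⇒≱ light
      (distance (linComb-closed isSubspace a members) (IsSubspace.𝟎-mem isSubspace) v≢𝟎)

  cosetDistribution : Distribution k
  cosetDistribution .mass = cosetMass
  cosetDistribution .nonNegative x = *-nonNegative (0≤2^- k)
    (*-nonNegative (∑-nonNegative {t} λ _ → 0≤1) (0≤δ (syndrome basis x) s))
  cosetDistribution .total = trans (∑-cong λ x → sym (trans
      (cong (λ b → cosetMass x * χ b) (dot-𝟎ʳ x)) (ℚ.*-identityʳ (cosetMass x))))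
    cosetMass-fourier-𝟎

  support⇒syndrome : ∀ x → x ∈ Support cosetDistribution → syndrome basis x ≡ s
  support⇒syndrome x x∈Q with ≡-dec Bool._≟_ (syndrome basis x) s
  ... | yes eq = eq
  ... | no  _  = contradiction
    (trans (cong (2^- k *_) (ℚ.*-zeroʳ (card t))) (ℚ.*-zeroʳ (2^- k))) x∈Q

  -- The event that `x` restricts to `y` is expanded in characters indexed by `b`, which turns the
  -- marginal into a combination of Fourier coefficients of `cosetMass` at the vectors `embed S b`.
  marginal-uniform : ∀ S → ∣ S ∣ ≡ r ∸ 1 → Uniform (marginal cosetDistribution S)
  marginal-uniform S ∣S∣≡r∸1 y = begin
    marginal cosetDistribution S y
      ≡⟨ ∑-cong (λ x → begin
           (if does (≡-dec Bool._≟_ (restrict S x) y) then cosetMass x else 0ℚ)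
             ≡⟨ if-*-δ (cosetMass x) (restrict S x) ⟩
           cosetMass x * δ (restrict S x) y
             ≡⟨ cong (cosetMass x *_) (δ-expand (restrict S x)) ⟩
           cosetMass x * (2^- m * ∑ (λ b → χ (dot b (restrict S x)) * χ (dot b y)))
             ≡⟨ solve 3 (λ p w q → p :* (w :* q) := w :* (p :* q)) refl (cosetMass x) (2^- m) _ ⟩
           2^- m * (cosetMass x * ∑ (λ b → χ (dot b (restrict S x)) * χ (dot b y)))
             ≡⟨ cong (2^- m *_) (trans (*-distribˡ-∑ {m} (cosetMass x) _) (∑-cong λ b →
                  trans (cong (λ c → cosetMass x * (χ c * χ (dot b y))) (dot-restrict S b x))
                    (solve 3 (λ p q u → p :* (q :* u) := u :* (p :* q)) refl
                      (cosetMass x) (χ (dot x (embed S b))) (χ (dot b y))))) ⟩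
           2^- m * ∑ (λ b → G b x) ∎) ⟩
    ∑ (λ x → 2^- m * ∑ (λ b → G b x))
      ≡⟨ *-distribˡ-∑ {k} (2^- m) _ ⟨
    2^- m * ∑ (λ x → ∑ (λ b → G b x))
      ≡⟨ cong (2^- m *_) (trans (∑-comm (λ x b → G b x))
           (∑-cong λ b → sym (*-distribˡ-∑ {k} (χ (dot b y)) _))) ⟩
    2^- m * ∑ (λ b → χ (dot b y) * ∑ (λ x → cosetMass x * χ (dot x (embed S b))))
      -- For `b` nonzero, `embed S b` is nonzero of weight below `r`, so its coefficient vanishes.
      ≡⟨ cong (2^- m *_) (∑-only-𝟎 λ b b≢𝟎 →
           trans (cong (χ (dot b y) *_) (cosetMass-fourier-light (b≢𝟎 ∘ embed≡𝟎⇒≡𝟎 S b)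
                                           (embed-light r S ∣S∣≡r∸1 b≢𝟎)))
                 (ℚ.*-zeroʳ (χ (dot b y)))) ⟩
    2^- m * (χ (dot 𝟎 y) * ∑ (λ x → cosetMass x * χ (dot x (embed S 𝟎))))
      ≡⟨ cong (2^- m *_) (cong₂ (λ b p → χ b * p) (dot-𝟎ˡ y)
           (trans (cong (λ v → ∑ (λ x → cosetMass x * χ (dot x v))) (embed-𝟎 S)) cosetMass-fourier-𝟎)) ⟩
    2^- m * 1ℚ
      ≡⟨ ℚ.*-identityʳ (2^- m) ⟩
    2^- m ∎
    where
    open +-*-Solver
    m = ∣ S ∣
    G : Bits m → Bits k → ℚ
    G b x = χ (dot b y) * (cosetMass x * χ (dot x (embed S b)))
    if-*-δ : ∀ p z → (if does (≡-dec Bool._≟_ z y) then p else 0ℚ) ≡ p * δ z y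
    if-*-δ p z with does (≡-dec Bool._≟_ z y)
    ... | true  = sym (ℚ.*-identityʳ p)
    ... | false = sym (ℚ.*-zeroʳ p)
    δ-expand : ∀ z → δ z y ≡ 2^- m * ∑ (λ b → χ (dot b z) * χ (dot b y))
    δ-expand z = sym (begin
      2^- m * ∑ (λ b → χ (dot b z) * χ (dot b y)) ≡⟨ cong (2^- m *_) (χ-orthogonal z y) ⟩
      2^- m * (card m * δ z y)                    ≡⟨ ℚ.*-assoc (2^- m) (card m) (δ z y) ⟨
      2^- m * card m * δ z y                      ≡⟨ cong (_* δ z y) (2^-n*card≡1 m) ⟩
      1ℚ * δ z y                                  ≡⟨ ℚ.*-identityˡ (δ z y) ⟩
      δ z y                                       ∎)

-- Pigeonhole for lists of bit vectors.

tailsAfter : ∀ {n} → Bool → List (Bits (suc n)) → List (Bits n)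
tailsAfter b     []                = []
tailsAfter false ((false ∷ x) ∷ L) = x ∷ tailsAfter false L
tailsAfter false ((true  ∷ x) ∷ L) = tailsAfter false L
tailsAfter true  ((false ∷ x) ∷ L) = tailsAfter true L
tailsAfter true  ((true  ∷ x) ∷ L) = x ∷ tailsAfter true L

length-tailsAfter : ∀ {n} (L : List (Bits (suc n))) →
                    length (tailsAfter false L) ℕ.+ length (tailsAfter true L) ≡ length L
length-tailsAfter []                = refl
length-tailsAfter ((false ∷ x) ∷ L) = cong suc (length-tailsAfter L)
length-tailsAfter ((true  ∷ x) ∷ L) = trans (ℕ.+-suc _ _) (cong suc (length-tailsAfter L))

∈-tailsAfter : ∀ {n} b {x : Bits n} {L} → (b ∷ x) ∈ˡ L → x ∈ˡ tailsAfter b L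
∈-tailsAfter false (here refl) = here refl
∈-tailsAfter true  (here refl) = here refl
∈-tailsAfter false {L = (false ∷ _) ∷ _} (there p) = there (∈-tailsAfter false p)
∈-tailsAfter false {L = (true  ∷ _) ∷ _} (there p) = ∈-tailsAfter false p
∈-tailsAfter true  {L = (false ∷ _) ∷ _} (there p) = ∈-tailsAfter true p
∈-tailsAfter true  {L = (true  ∷ _) ∷ _} (there p) = there (∈-tailsAfter true p)

-- Bisection on the first bit: the two lists of tails share the length of `L`, so one of them is
-- shorter than `2 ^ t`, and a vector it misses extends to one that `L` misses.
missing : ∀ {t} (L : List (Bits t)) → length L < 2 ^ t → ∃[ s ] s ∉ˡ L
missing {zero}  []      _ = [] , λ ()
missing {zero}  (_ ∷ _) (s≤s ())
missing {suc t} L short with length (tailsAfter false L) ℕ.<? 2 ^ t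
... | yes short₀ = let s , s∉ = missing (tailsAfter false L) short₀ in
                   false ∷ s , s∉ ∘ ∈-tailsAfter false
... | no  long₀  = let s , s∉ = missing (tailsAfter true L) short₁ in
                   true ∷ s , s∉ ∘ ∈-tailsAfter true
  where
  short₁ : length (tailsAfter true L) < 2 ^ t
  -- The tails after `false` number at least `2 ^ t`; this is cancelled from the bound `2 ^ suc t`,
  -- which unfolds to `2 ^ t + (2 ^ t + 0)`.
  short₁ = ℕ.+-cancelˡ-< (2 ^ t) _ _ (ℕ.≤-<-trans
    (ℕ.+-monoˡ-≤ (length (tailsAfter true L)) (ℕ.≮⇒≥ long₀))
    (subst₂ _<_ (sym (length-tailsAfter L)) (cong (2 ^ t ℕ.+_) (ℕ.+-identityʳ (2 ^ t))) short))

-- Falsified clauses and the choice of a coset.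

falsifier : ∀ {n k} → (Fin k ↣ Fin n) → Bits n → Bits k
falsifier I σ = tabulate λ i → not (lookup σ (Injection.to I i))

-- Over two values, disagreeing with `σ` at every listed variable determines each bit of `x`, which
-- forces `x` to be the falsifier.
satisfied : ∀ {n k} (I : Fin k ↣ Fin n) σ x → x ≢ falsifier I σ → Satisfies σ (I , x)
satisfied I σ x x≢ with any? (λ i → lookup x i Bool.≟ lookup σ (Injection.to I i))
... | yes sat   = sat
... | no  unsat = contradiction
  (trans (sym (tabulate∘lookup x)) (tabulate-cong λ i → Bool.¬-not λ eq → unsat (i , eq))) x≢

theorem4 : ∀ (k t r : ℕ) → LinearCode k t r →
    ∀ (n : ℕ) (I : Fin k ↣ Fin n) (𝒜 : List (Bits n)) → Unique 𝒜 → length 𝒜 ≤ 2 ^ t ∸ 1 →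
    Σ[ Q ∈ Distribution k ]
    (∀ x → x ∈ Support Q → All (λ σ → Satisfies σ (I , x)) 𝒜) ×
    (∀ (S : Subset k) → ∣ S ∣ ≡ r ∸ 1 → Uniform (marginal Q S))
theorem4 k t r C n I 𝒜 _ ∣𝒜∣≤2^t∸1
  -- Each assignment excludes one syndrome, that of its falsifier. Since `2 ^ t` is nonzero, the
  -- bound by `2 ^ t ∸ 1` is strict inequality with `2 ^ t`, and some syndrome `s` remains.
  with missing (List.map (syndrome (LinearCode.basis C) ∘ falsifier I) 𝒜)
         (subst₂ _<_ (sym (length-map _ 𝒜)) (ℕ.suc-pred (2 ^ t) {{ℕ.m^n≢0 2 t}}) (s≤s ∣𝒜∣≤2^t∸1))
... | s , s∉ = cosetDistribution C s , satisfies , marginal-uniform C s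
  where
  satisfies : ∀ x → x ∈ Support (cosetDistribution C s) → All (λ σ → Satisfies σ (I , x)) 𝒜
  -- Were `x` the falsifier of some `σ` in `𝒜`, its syndrome `s` would be among the excluded ones.
  satisfies x x∈Q = All.tabulate λ {σ} σ∈𝒜 → satisfied I σ x λ { refl →
    s∉ (subst (_∈ˡ _) (support⇒syndrome C s x x∈Q)
              (∈-map⁺ (syndrome (LinearCode.basis C) ∘ falsifier I) σ∈𝒜)) }
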